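{- The system $\mathsf{KSdli}$ polynomially simulates the Analytic Gentzen system: there is a polynomial $p$ such that for every proof $\Phi$ in Analytic Gentzen there is a proof $\Pi$ in $\mathsf{KSdli}$ of the same formula with $|\Pi|\le p(|\Phi|)$.
   Context: Classical logic structures are generated by $R ::= \mathsf{f\!f}\mid\mathsf{t\!t}\mid a\mid [R\lor R]\mid(R\land R)\mid\overline R$, where $a$ ranges over countably many atomic propositions, and $\mathsf{f\!f},\mathsf{t\!t}$ are the units false and true. $[R\lor T]$ is a disjunction, $(R\land T)$ a conjunction. Structures are considered modulo $\approx$, the smallest congruence induced by associativity and commutativity of $\lor$ and of $\land$ and the De Morgan equations for negation, and are taken in negation normal form. A context $S\{\ \}$ is a structure with one hole not in the scope of a negation; $S[R\lor T]$, $S(R\land T)$ abbreviate $S\{[R\lor T]\}$, $S\{(R\land T)\}$. System $\mathsf{KSdli}$ has the rules (for all contexts $S\{\ \}$, structures $R,T,U$, atoms $a$): - $\mathsf{ai}{\downarrow}$: premise $S\{\mathsf{t\!t}\}$, conclusion $S[a\lor\overline a]$. - $\mathsf{dlis}$: premise $S([U\lor R]\land T)$, conclusion $S[U\lor(R\land T)]$, provided $\mathsf{at}\,\overline R\cap\mathsf{at}\,U\ne\emptyset$, $U$ is a conjunction or an atom different from $\mathsf{f\!f}$, and $R$ is a disjunction or an atom different from $\mathsf{t\!t}$. - $\mathsf w{\downarrow}$: premise $S\{\mathsf{f\!f}\}$, conclusion $S\{R\}$. - $\mathsf c{\downarrow}$: premise $S[R\lor R]$, conclusion $S\{R\}$.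 - $\mathsf u_1{\downarrow}$: premise $S\{R\}$, conclusion $S[R\lor\mathsf{f\!f}]$. - $\mathsf u_2{\downarrow}$: premise $S\{R\}$, conclusion $S(R\land\mathsf{t\!t})$. - $\mathsf u_3{\downarrow}$: premise $S\{\mathsf{t\!t}\}$, conclusion $S[\mathsf{t\!t}\lor\mathsf{t\!t}]$. - $\mathsf u_4{\downarrow}$: premise $S\{\mathsf{f\!f}\}$, conclusion $S(\mathsf{f\!f}\land\mathsf{f\!f})$. Here $\mathsf{at}\,R$ is the set of atoms occurring in $R$ in negation normal form ($a$ and $\overline a$ are different elements), and the units count as special atoms, dual to each other. A proof of $R$ is a finite chain of rule instances (possibly none) with top-most structure $\mathsf{t\!t}$ and bottom-most structure $R$. Analytic Gentzen is the sequent calculus over formulae (same grammar, not taken modulo $\approx$), with sequents $\vdash\phi$ where $\phi,\psi$ are multisets of formulae interpreted as disjunctions, and rules: axiom $\vdash A,\overline A$; axiom $\vdash\mathsf{t\!t}$; weakening: from $\vdash\phi$ infer $\vdash\phi,A$; contraction: from $\vdash\phi,A,A$ infer $\vdash\phi,A$; $\lor$: from $\vdash\phi,A,B$ infer $\vdash\phi,[A\lor B]$; $\land$: from $\vdash\phi,A$ and $\vdash B,\psi$ infer $\vdash\phi,(A\land B),\psi$. Derivations are trees of rule instances; a proof is a derivation without premises. The size $|\cdot|$ of a proof (in either system) is the number of unit and atom occurrences appearing in it. -}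

module Defs where

open import Data.List using (List; []; _∷_; _++_; map; sum; foldr)
open import Data.List.Membership.Propositional using (_∈_)
open import Data.List.Relation.Binary.Permutation.Propositional using (_↭_)
open import Data.Nat using (ℕ; _+_; _*_)
open import Data.Product using (_×_; ∃-syntax)
open import Data.Sum using (_⊎_)
open import Relation.Binary.PropositionalEquality using (_≢_)

infixr 6 _∧_
infixr 5 _∨_
infix  7 ∼_
infix  4 _≈_ _↝_ _⟶_
infix  3 ⊢_

data Formula : Set where
  ff tt   : Formula
  atom    : ℕ → Formula
  _∨_ _∧_ : Formula → Formula → Formula
  ∼_      : Formula → Formula

-- A structure is a formula considered modulo _≈_.
Structure : Set
Structure = Formula

data _≈_ : Structure → Structure → Set where
  ≈-refl  : ∀ {R} → R ≈ R
  ≈-sym   : ∀ {R T} → R ≈ T → T ≈ R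
  ≈-trans : ∀ {R T U} → R ≈ T → T ≈ U → R ≈ U

  ∨-cong  : ∀ {R R′ T T′} → R ≈ R′ → T ≈ T′ → R ∨ T ≈ R′ ∨ T′
  ∧-cong  : ∀ {R R′ T T′} → R ≈ R′ → T ≈ T′ → R ∧ T ≈ R′ ∧ T′
  ∼-cong  : ∀ {R R′} → R ≈ R′ → ∼ R ≈ ∼ R′

  ∨-assoc : ∀ R T U → (R ∨ T) ∨ U ≈ R ∨ (T ∨ U)
  ∧-assoc : ∀ R T U → (R ∧ T) ∧ U ≈ R ∧ (T ∧ U)
  ∨-comm  : ∀ R T → R ∨ T ≈ T ∨ R
  ∧-comm  : ∀ R T → R ∧ T ≈ T ∧ R

  ∼-∨     : ∀ R T → ∼ (R ∨ T) ≈ ∼ R ∧ ∼ T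
  ∼-∧     : ∀ R T → ∼ (R ∧ T) ≈ ∼ R ∨ ∼ T
  ∼-∼     : ∀ R → ∼ ∼ R ≈ R
  ∼-ff    : ∼ ff ≈ tt
  ∼-tt    : ∼ tt ≈ ff

-- The leaves of a negation normal form; the units count as atoms.
data Literal : Set where
  ffˡ ttˡ : Literal
  pos neg : ℕ → Literal

⌜_⌝ : Literal → Structure
⌜ ffˡ   ⌝ = ff
⌜ ttˡ   ⌝ = tt
⌜ pos a ⌝ = atom a
⌜ neg a ⌝ = ∼ atom a

dual : Literal → Literal
dual ffˡ     = ttˡ
dual ttˡ     = ffˡ
dual (pos a) = neg a
dual (neg a) = pos a

-- The leaves of the negation normal form of a structure: pushing a negation
-- inwards exchanges ∨ and ∧ and replaces every leaf by its dual.
at : Structure → List Literal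
at ff       = ffˡ ∷ []
at tt       = ttˡ ∷ []
at (atom a) = pos a ∷ []
at (R ∨ T)  = at R ++ at T
at (R ∧ T)  = at R ++ at T
at (∼ R)    = map dual (at R)

IsDisjunction : Structure → Set
IsDisjunction R = ∃[ P ] ∃[ Q ] R ≈ P ∨ Q

IsConjunction : Structure → Set
IsConjunction R = ∃[ P ] ∃[ Q ] R ≈ P ∧ Q

IsAtomOtherThan : Literal → Structure → Set
IsAtomOtherThan l R = ∃[ k ] k ≢ l × R ≈ ⌜ k ⌝

data Context : Set where
  □         : Context
  _∨ˡ_ _∧ˡ_ : Context → Structure → Context
  _∨ʳ_ _∧ʳ_ : Structure → Context → Context

_⟨_⟩ : Context → Structure → Structure
□        ⟨ R ⟩ = R
(S ∨ˡ T) ⟨ R ⟩ = S ⟨ R ⟩ ∨ T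
(S ∧ˡ T) ⟨ R ⟩ = S ⟨ R ⟩ ∧ T
(T ∨ʳ S) ⟨ R ⟩ = T ∨ S ⟨ R ⟩
(T ∧ʳ S) ⟨ R ⟩ = T ∧ S ⟨ R ⟩

-- P ↝ Q: a rule takes premise S{P} to conclusion S{Q}, for every context S.
data _↝_ : Structure → Structure → Set where
  ai↓  : ∀ a → tt ↝ atom a ∨ ∼ atom a
  dlis : ∀ R T U →
         ∃[ l ] (l ∈ at (∼ R) × l ∈ at U) →
         IsConjunction U ⊎ IsAtomOtherThan ffˡ U →
         IsDisjunction R ⊎ IsAtomOtherThan ttˡ R →
         (U ∨ R) ∧ T ↝ U ∨ (R ∧ T)
  w↓   : ∀ R → ff ↝ R
  c↓   : ∀ R → R ∨ R ↝ R
  u₁↓  : ∀ R → R ↝ R ∨ ff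
  u₂↓  : ∀ R → R ↝ R ∧ tt
  u₃↓  : tt ↝ tt ∨ tt
  u₄↓  : ff ↝ ff ∧ ff

data _⟶_ (P Q : Structure) : Set where
  instance-in : ∀ S {R T} → P ≈ S ⟨ R ⟩ → R ↝ T → S ⟨ T ⟩ ≈ Q → P ⟶ Q

data KSdli : Structure → Set where
  start : ∀ {R} → tt ≈ R → KSdli R
  step  : ∀ {P Q} → KSdli P → P ⟶ Q → KSdli Q

-- Multisets of formulae are lists up to _↭_.
Sequent : Set
Sequent = List Formula

data ⊢_ : Sequent → Set where
  exchange    : ∀ {φ ψ} → φ ↭ ψ → ⊢ φ → ⊢ ψ
  identity    : ∀ A → ⊢ A ∷ ∼ A ∷ []
  truth       : ⊢ tt ∷ []
  weakening   : ∀ {φ} A → ⊢ φ → ⊢ A ∷ φ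
  contraction : ∀ {φ A} → ⊢ A ∷ A ∷ φ → ⊢ A ∷ φ
  ∨-rule      : ∀ {φ A B} → ⊢ A ∷ B ∷ φ → ⊢ (A ∨ B) ∷ φ
  ∧-rule      : ∀ {φ ψ A B} → ⊢ A ∷ φ → ⊢ B ∷ ψ → ⊢ (A ∧ B) ∷ φ ++ ψ

-- A one-formula sequent denotes that formula itself. The empty sequent is
-- not provable, so its value is irrelevant.
⋁ : Sequent → Formula
⋁ []          = ff
⋁ (A ∷ [])    = A
⋁ (A ∷ B ∷ φ) = A ∨ ⋁ (B ∷ φ)

size : Formula → ℕ
size ff       = 1
size tt       = 1
size (atom a) = 1
size (A ∨ B)  = size A + size B
size (A ∧ B)  = size A + size B
size (∼ A)    = size A

sequentSize : Sequent → ℕ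
sequentSize φ = sum (map size φ)

-- Invariance of size under _≈_ makes this independent of representatives.
KSdliSize : ∀ {R} → KSdli R → ℕ
KSdliSize {R} (start _)  = size R
KSdliSize {R} (step Π _) = KSdliSize Π + size R

-- Exchange only changes the list representing a multiset; it is not an
-- inference of the calculus, so it contributes nothing.
gentzenSize : ∀ {φ} → ⊢ φ → ℕ
gentzenSize     (exchange _ Φ)    = gentzenSize Φ
gentzenSize {φ} (identity _)      = sequentSize φ
gentzenSize {φ} truth             = sequentSize φ
gentzenSize {φ} (weakening _ Φ)   = gentzenSize Φ + sequentSize φ
gentzenSize {φ} (contraction Φ)   = gentzenSize Φ + sequentSize φ
gentzenSize {φ} (∨-rule Φ)        = gentzenSize Φ + sequentSize φ
gentzenSize {φ} (∧-rule Φ Ψ)      = gentzenSize Φ + gentzenSize Ψ + sequentSize φ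

-- Coefficients, constant term first. Natural coefficients suffice for
-- upper bounds.
Polynomial : Set
Polynomial = List ℕ

eval : Polynomial → ℕ → ℕ
eval p n = foldr (λ c v → c + n * v) 0 p

{-# OPTIONS --safe #-}
module Submission where

-- The only obstacle is the ∧-rule: from U ∨ A and B ∨ V the ordinary switch gives
-- U ∨ (A ∧ B) ∨ V, but dlis moves U out only past something it interacts with.
-- So each sequent is flattened into its non-disjunctive components, and the
-- simulation produces a derivation not of all of them but of a core: a sublist
-- connected in the graph whose edges are the pairs sharing dual literals. If the
-- components of A miss the core, the core of that premise already serves for the
-- conclusion. Otherwise a spanning tree rooted at A orders the remaining
-- components so that dlis can pull them out one at a time, leaves first.
-- Connectedness survives, since contraction identifies vertices and the ∧-rule
-- glues two connected graphs along A ∧ B.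

open import Defs
open import Data.List using (List; []; _∷_; _++_; length; foldr; concatMap; [_])
open import Data.List.Properties using (foldr-++; map-++; concatMap-++; ++-identityʳ; ++-assoc)
open import Data.List.Membership.Propositional using (_∈_)
open import Data.List.Membership.Propositional.Properties
  using (∈-++⁺ˡ; ∈-++⁺ʳ; ∈-++⁻; ∈-map⁺; ∈-map⁻; ∈-∃++)
open import Data.List.Relation.Binary.Permutation.Propositional
  using (_↭_; refl; prep; swap; ↭-sym; ↭-refl; ↭-trans)
open import Data.List.Relation.Binary.Permutation.Propositional.Properties
  using (All-resp-↭; ∈-resp-↭; shift; shifts; drop-∷; ↭-length; ++⁺ˡ; ++⁺ʳ; ++-comm)
open import Data.List.Relation.Binary.Sublist.Propositional
  using (_⊆_; []; _∷_; _∷ʳ_)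
open import Data.List.Relation.Binary.Sublist.Propositional.Properties
  using (All-resp-⊆) renaming (++⁺ to ⊆-++⁺; ++⁺ˡ to ⊆-++⁺ˡ; ++⁺ʳ to ⊆-++⁺ʳ)
open import Data.List.Relation.Unary.All using (All; []; _∷_)
import Data.List.Relation.Unary.All as All
import Data.List.Relation.Unary.All.Properties as All
open import Data.List.Relation.Unary.Any using (here; there)
open import Data.Nat using (ℕ; zero; suc; _+_; _*_; _≤_; z≤n; s≤s)
open import Data.Nat.Properties
open import Data.Nat.Tactic.RingSolver using (solve-∀)
open import Data.Product using (Σ-syntax; ∃-syntax; _×_; _,_)
open import Data.Sum using (_⊎_; inj₁; inj₂)
open import Relation.Binary.PropositionalEquality
  using (_≡_; refl; sym; trans; cong; cong₂; subst)

-- Sizes and iterated disjunctions.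

size-≈ : ∀ {P Q} → P ≈ Q → size P ≡ size Q
size-≈ ≈-refl          = refl
size-≈ (≈-sym e)       = sym (size-≈ e)
size-≈ (≈-trans e f)   = trans (size-≈ e) (size-≈ f)
size-≈ (∨-cong e f)    = cong₂ _+_ (size-≈ e) (size-≈ f)
size-≈ (∧-cong e f)    = cong₂ _+_ (size-≈ e) (size-≈ f)
size-≈ (∼-cong e)      = size-≈ e
size-≈ (∨-assoc R T U) = +-assoc (size R) (size T) (size U)
size-≈ (∧-assoc R T U) = +-assoc (size R) (size T) (size U)
size-≈ (∨-comm R T)    = +-comm (size R) (size T)
size-≈ (∧-comm R T)    = +-comm (size R) (size T)
size-≈ (∼-∨ R T)       = refl
size-≈ (∼-∧ R T)       = refl
size-≈ (∼-∼ R)         = refl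
size-≈ ∼-ff            = refl
size-≈ ∼-tt            = refl

1≤size : ∀ A → 1 ≤ size A
1≤size ff       = ≤-refl
1≤size tt       = ≤-refl
1≤size (atom a) = ≤-refl
1≤size (A ∨ B)  = m≤n⇒m≤n+o (size B) (1≤size A)
1≤size (A ∧ B)  = m≤n⇒m≤n+o (size B) (1≤size A)
1≤size (∼ A)    = 1≤size A

≡⇒≈ : ∀ {P Q} → P ≡ Q → P ≈ Q
≡⇒≈ refl = ≈-refl

infixr 5 _⋎_
-- Units are not neutral for `≈`, so a list is always read over a tail `R`, usually `ff`; the empty
-- list then needs no special case.
_⋎_ : List Formula → Formula → Formula
Γ ⋎ R = foldr _∨_ R Γ

⋎-++ : ∀ Γ Δ {R} → (Γ ++ Δ) ⋎ R ≡ Γ ⋎ Δ ⋎ R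
⋎-++ Γ Δ {R} = foldr-++ _∨_ R Γ Δ

⋎-cong : ∀ Γ {P Q} → P ≈ Q → Γ ⋎ P ≈ Γ ⋎ Q
⋎-cong []      e = e
⋎-cong (A ∷ Γ) e = ∨-cong ≈-refl (⋎-cong Γ e)

∨-swap : ∀ P Q R → P ∨ (Q ∨ R) ≈ Q ∨ (P ∨ R)
∨-swap P Q R = ≈-trans (≈-sym (∨-assoc P Q R))
  (≈-trans (∨-cong (∨-comm P Q) ≈-refl) (∨-assoc Q P R))

⋎-↭ : ∀ {Γ Δ R} → Γ ↭ Δ → Γ ⋎ R ≈ Δ ⋎ R
⋎-↭ refl         = ≈-refl
⋎-↭ (prep A p)   = ∨-cong ≈-refl (⋎-↭ p)
⋎-↭ {R = R} (swap {xs = Γ} A B p) =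
  ≈-trans (∨-swap A B (Γ ⋎ R)) (∨-cong ≈-refl (∨-cong ≈-refl (⋎-↭ p)))
⋎-↭ (_↭_.trans p q) = ≈-trans (⋎-↭ p) (⋎-↭ q)

size-⋎ : ∀ Γ R → size (Γ ⋎ R) ≡ sequentSize Γ + size R
size-⋎ []      R = refl
size-⋎ (A ∷ Γ) R = trans (cong (size A +_) (size-⋎ Γ R)) (sym (+-assoc (size A) _ _))

sequentSize-++ : ∀ Γ Δ → sequentSize (Γ ++ Δ) ≡ sequentSize Γ + sequentSize Δ
sequentSize-++ []      Δ = refl
sequentSize-++ (A ∷ Γ) Δ = trans (cong (size A +_) (sequentSize-++ Γ Δ)) (sym (+-assoc (size A) _ _))

sequentSize-⊆ : ∀ {Γ Δ} → Γ ⊆ Δ → sequentSize Γ ≤ sequentSize Δ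
sequentSize-⊆ []         = z≤n
sequentSize-⊆ (A ∷ʳ s)   = m≤n⇒m≤o+n (size A) (sequentSize-⊆ s)
sequentSize-⊆ (_∷_ {x = A} refl s) = +-monoʳ-≤ (size A) (sequentSize-⊆ s)

length≤sequentSize : ∀ Γ → length Γ ≤ sequentSize Γ
length≤sequentSize []      = z≤n
length≤sequentSize (A ∷ Γ) = +-mono-≤ (1≤size A) (length≤sequentSize Γ)

-- Derivations bounded in length and width.

-- Der w k P Q: at most k steps, in which every line after P has size at most w.
infixl 4 _▹_
data Der (w : ℕ) : ℕ → Structure → Structure → Set where
  done : ∀ {k P Q} → P ≈ Q → Der w k P Q
  step : ∀ {k P Q R} → Der w k P Q → Q ⟶ R → size R ≤ w → Der w (suc k) P R

respʳ : ∀ {w k P Q R} → Der w k P Q → Q ≈ R → Der w k P R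
respʳ (done e) f = done (≈-trans e f)
respʳ (step d (instance-in S p r q) b) f =
  step d (instance-in S p r (≈-trans q f)) (≤-trans (≤-reflexive (sym (size-≈ f))) b)

relax : ∀ {w w′ k k′ P Q} → k ≤ k′ → w ≤ w′ → Der w k P Q → Der w′ k′ P Q
relax _       _ (done e)     = done e
relax (s≤s p) q (step d i b) = step (relax p q d) i (≤-trans b q)

_▹_ : ∀ {w k l P Q R} → Der w k P Q → Der w l Q R → Der w (l + k) P R
d ▹ done {k = l} e = relax (m≤n+m _ l) ≤-refl (respʳ d e)
d ▹ step d′ i b    = step (d ▹ d′) i b

respˡ : ∀ {w k P Q R} → P ≈ Q → Der w k Q R → Der w k P R
respˡ e (done f)     = done (≈-trans e f)
respˡ e (step d i b) = step (respˡ e d) i b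

rule : ∀ {w k R T} → R ↝ T → size T ≤ w → Der w (suc k) R T
rule r b = step (done ≈-refl) (instance-in □ ≈-refl r ≈-refl) b

under-∨ : ∀ {w k P Q} T → Der w k P Q → Der (size T + w) k (T ∨ P) (T ∨ Q)
under-∨ T (done e) = done (∨-cong ≈-refl e)
under-∨ T (step d (instance-in S p r q) b) =
  step (under-∨ T d)
       (instance-in (T ∨ʳ S) (∨-cong ≈-refl p) r (∨-cong ≈-refl q))
       (+-monoʳ-≤ (size T) b)

under-∧ : ∀ {w k P Q} T → Der w k P Q → Der (size T + w) k (T ∧ P) (T ∧ Q)
under-∧ T (done e) = done (∧-cong ≈-refl e)
under-∧ T (step d (instance-in S p r q) b) =
  step (under-∧ T d)
       (instance-in (T ∧ʳ S) (∧-cong ≈-refl p) r (∧-cong ≈-refl q))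
       (+-monoʳ-≤ (size T) b)

under-⋎ : ∀ {w k P Q} Γ → Der w k P Q → Der (sequentSize Γ + w) k (Γ ⋎ P) (Γ ⋎ Q)
under-⋎ []      d = d
under-⋎ (A ∷ Γ) d =
  relax ≤-refl (≤-reflexive (sym (+-assoc (size A) _ _))) (under-∨ A (under-⋎ Γ d))

-- `w↓` can only replace an `ff`, which `u₁↓` has to create first.
weaken : ∀ P Q → Der (size Q + size P) 2 P (Q ∨ P)
weaken P Q =
  respʳ (step (rule (u₁↓ P) b)
          (instance-in (P ∨ʳ □) ≈-refl (w↓ Q) ≈-refl)
          (≤-reflexive (+-comm (size P) (size Q))))
        (∨-comm P Q)
  where
  b : size P + 1 ≤ size Q + size P
  b = ≤-trans (≤-reflexive (+-comm (size P) 1)) (+-monoˡ-≤ (size P) (1≤size Q))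

-- No rule deletes a disjunct `ff` outright: it is weakened to a second copy of `P`, and the two
-- copies are contracted.
drop-ff : ∀ P → Der (size P + size P) 2 (P ∨ ff) P
drop-ff P = step
  (step (done ≈-refl) (instance-in (P ∨ʳ □) ≈-refl (w↓ P) ≈-refl) ≤-refl)
  (instance-in □ ≈-refl (c↓ P) ≈-refl) (m≤m+n _ _)

toKSdli : ∀ {w k R} → Der w k tt R → Σ[ Π ∈ KSdli R ] KSdliSize Π ≤ 1 + k * w
toKSdli (done e) = start e , ≤-trans (≤-reflexive (sym (size-≈ e))) (m≤m+n 1 _)
toKSdli {w} {suc k} (step d i b) with toKSdli d
... | Π , Π≤ = step Π i , ≤-trans (+-mono-≤ Π≤ b) (s≤s (≤-reflexive (+-comm (k * w) w)))

-- Components: the non-disjunctive parts of the negation normal form, without ff.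

comps : Formula → List Formula
comps ff          = []
comps tt          = [ tt ]
comps (atom a)    = [ atom a ]
comps (A ∨ B)     = comps A ++ comps B
comps (A ∧ B)     = [ A ∧ B ]
comps (∼ ff)      = [ tt ]
comps (∼ tt)      = []
comps (∼ atom a)  = [ ∼ atom a ]
comps (∼ (A ∨ B)) = [ ∼ (A ∨ B) ]
comps (∼ (A ∧ B)) = comps (∼ A) ++ comps (∼ B)
comps (∼ ∼ A)     = comps A

flat : Sequent → List Formula
flat = concatMap comps

sequentSize-comps : ∀ A → sequentSize (comps A) ≤ size A
sequentSize-comps ff          = z≤n
sequentSize-comps tt          = ≤-refl
sequentSize-comps (atom a)    = ≤-refl
sequentSize-comps (A ∨ B)     = ≤-trans (≤-reflexive (sequentSize-++ (comps A) _))
  (+-mono-≤ (sequentSize-comps A) (sequentSize-comps B))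
sequentSize-comps (A ∧ B)     = ≤-reflexive (+-identityʳ _)
sequentSize-comps (∼ ff)      = ≤-refl
sequentSize-comps (∼ tt)      = z≤n
sequentSize-comps (∼ atom a)  = ≤-refl
sequentSize-comps (∼ (A ∨ B)) = ≤-reflexive (+-identityʳ _)
sequentSize-comps (∼ (A ∧ B)) = ≤-trans (≤-reflexive (sequentSize-++ (comps (∼ A)) _))
  (+-mono-≤ (sequentSize-comps (∼ A)) (sequentSize-comps (∼ B)))
sequentSize-comps (∼ ∼ A)     = sequentSize-comps A

sequentSize-flat : ∀ φ → sequentSize (flat φ) ≤ sequentSize φ
sequentSize-flat []      = z≤n
sequentSize-flat (A ∷ φ) = ≤-trans (≤-reflexive (sequentSize-++ (comps A) _))
  (+-mono-≤ (sequentSize-comps A) (sequentSize-flat φ))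

flat-↭ : ∀ {φ ψ} → φ ↭ ψ → flat φ ↭ flat ψ
flat-↭ refl       = ↭-refl
flat-↭ (prep A p) = ++⁺ˡ (comps A) (flat-↭ p)
flat-↭ (swap A B p) =
  ↭-trans (shifts (comps A) (comps B)) (++⁺ˡ (comps B) (++⁺ˡ (comps A) (flat-↭ p)))
flat-↭ (_↭_.trans p q) = ↭-trans (flat-↭ p) (flat-↭ q)

-- The side condition of dlis on U.
Extractable : Formula → Set
Extractable U = IsConjunction U ⊎ IsAtomOtherThan ffˡ U

-- This is why `comps` discards `ff` and `∼ tt`: `ff` is the one literal that the side condition on
-- `U` excludes.
comps-extractable : ∀ A → All Extractable (comps A)
comps-extractable ff          = []
comps-extractable tt          = inj₂ (ttˡ , (λ ()) , ≈-refl) ∷ []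
comps-extractable (atom a)    = inj₂ (pos a , (λ ()) , ≈-refl) ∷ []
comps-extractable (A ∨ B)     = All.++⁺ (comps-extractable A) (comps-extractable B)
comps-extractable (A ∧ B)     = inj₁ (A , B , ≈-refl) ∷ []
comps-extractable (∼ ff)      = inj₂ (ttˡ , (λ ()) , ≈-refl) ∷ []
comps-extractable (∼ tt)      = []
comps-extractable (∼ atom a)  = inj₂ (neg a , (λ ()) , ≈-refl) ∷ []
comps-extractable (∼ (A ∨ B)) = inj₁ (∼ A , ∼ B , ∼-∨ A B) ∷ []
comps-extractable (∼ (A ∧ B)) = All.++⁺ (comps-extractable (∼ A)) (comps-extractable (∼ B))
comps-extractable (∼ ∼ A)     = comps-extractable A

weaken-⋎ : ∀ {Γ Δ} R → Γ ⊆ Δ → Der (sequentSize Δ + size R) (length Δ * 2) (Γ ⋎ R) (Δ ⋎ R)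
weaken-⋎ R [] = done ≈-refl
weaken-⋎ R (_∷ʳ_ {ys = Δ} A s) =
  relax ≤-refl (+-monoˡ-≤ (size R) (m≤n+m _ (size A))) (weaken-⋎ R s)
  ▹ relax ≤-refl (≤-reflexive (size-⋎ (A ∷ Δ) R)) (weaken (Δ ⋎ R) A)
weaken-⋎ R (_∷_ {x = A} refl s) =
  relax (m≤n+m _ 2) (≤-reflexive (sym (+-assoc (size A) _ _))) (under-∨ A (weaken-⋎ R s))

-- The only proper steps are the `u₁↓` that restore the units discarded by `comps`, at most one per
-- leaf of `A`; the rest holds up to `≈`.
assemble : ∀ A R → Der (size A + size R) (size A) (comps A ⋎ R) (A ∨ R)
assemble-∨ : ∀ A B {C} R → A ∨ B ≈ C →
             Der (size A + size B + size R) (size A + size B) ((comps A ++ comps B) ⋎ R) (C ∨ R)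
assemble-∨ A B {C} R e = respˡ (≡⇒≈ (⋎-++ (comps A) (comps B)))
  (respʳ (relax ≤-refl w₁ (under-⋎ (comps A) (assemble B R))
          ▹ relax ≤-refl (≤-reflexive (sym (+-assoc (size A) _ _))) (assemble A (B ∨ R)))
        (≈-trans (≈-sym (∨-assoc A B R)) (∨-cong e ≈-refl)))
  where
  w₁ : sequentSize (comps A) + (size B + size R) ≤ size A + size B + size R
  w₁ = ≤-trans (+-monoˡ-≤ _ (sequentSize-comps A)) (≤-reflexive (sym (+-assoc (size A) _ _)))

assemble ff          R = respʳ (rule (u₁↓ R) (≤-reflexive (+-comm (size R) 1))) (∨-comm R ff)
assemble tt          R = done ≈-refl
assemble (atom a)    R = done ≈-refl
assemble (A ∨ B)     R = assemble-∨ A B R ≈-refl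
assemble (A ∧ B)     R = done ≈-refl
assemble (∼ ff)      R = done (∨-cong (≈-sym ∼-ff) ≈-refl)
assemble (∼ tt)      R = respʳ (rule (u₁↓ R) (≤-reflexive (+-comm (size R) 1)))
  (≈-trans (∨-comm R ff) (∨-cong (≈-sym ∼-tt) ≈-refl))
assemble (∼ atom a)  R = done ≈-refl
assemble (∼ (A ∨ B)) R = done ≈-refl
assemble (∼ (A ∧ B)) R = assemble-∨ (∼ A) (∼ B) R (≈-sym (∼-∧ A B))
assemble (∼ ∼ A)     R = respʳ (assemble A R) (∨-cong (≈-sym (∼-∼ A)) ≈-refl)

-- The interaction graph

infix 4 _⊑_
_⊑_ : Formula → Formula → Set
R ⊑ T = ∀ l → l ∈ at R → l ∈ at T

dual-involutive : ∀ l → dual (dual l) ≡ l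
dual-involutive ffˡ     = refl
dual-involutive ttˡ     = refl
dual-involutive (pos a) = refl
dual-involutive (neg a) = refl

∈-at-∼ : ∀ {l} R → l ∈ at R → dual l ∈ at (∼ R)
∈-at-∼ R = ∈-map⁺ dual

at-∼⁻ : ∀ {l} R → l ∈ at (∼ R) → dual l ∈ at R
at-∼⁻ R l∈ with ∈-map⁻ dual l∈
... | m , m∈ , refl = subst (_∈ at R) (sym (dual-involutive m)) m∈

-- The side condition of dlis relating R and U.
Interacts : Formula → Formula → Set
Interacts R U = ∃[ l ] (l ∈ at (∼ R) × l ∈ at U)

interacts-mono : ∀ R T U → R ⊑ T → Interacts R U → Interacts T U
interacts-mono R T U R⊑T (l , l∈R , l∈U) =
  l , subst (_∈ at (∼ T)) (dual-involutive l) (∈-at-∼ T (R⊑T _ (at-∼⁻ R l∈R))) , l∈U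

at-⋎⁻ : ∀ {l R} Γ → l ∈ at (Γ ⋎ R) → ∃[ A ] (A ∈ R ∷ Γ × l ∈ at A)
at-⋎⁻ {R = R} [] l∈ = R , here refl , l∈
at-⋎⁻ (A ∷ Γ) l∈ with ∈-++⁻ (at A) l∈
... | inj₁ l∈A = A , there (here refl) , l∈A
... | inj₂ l∈Γ with at-⋎⁻ Γ l∈Γ
...   | B , here e  , l∈B = B , here e , l∈B
...   | B , there i , l∈B = B , there (there i) , l∈B

at-⋎⁺ : ∀ {l R A} Γ → A ∈ R ∷ Γ → l ∈ at A → l ∈ at (Γ ⋎ R)
at-⋎⁺ []      (here refl)         l∈ = l∈
at-⋎⁺ (B ∷ Γ) (here refl)         l∈ = ∈-++⁺ʳ (at B) (at-⋎⁺ Γ (here refl) l∈)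
at-⋎⁺ (B ∷ Γ) (there (here refl)) l∈ = ∈-++⁺ˡ l∈
at-⋎⁺ (B ∷ Γ) (there (there i))   l∈ = ∈-++⁺ʳ (at B) (at-⋎⁺ Γ (there i) l∈)

⋎-⊑ : ∀ Γ Δ {R T} → (∀ {A} → A ∈ R ∷ Γ → ∃[ B ] (B ∈ T ∷ Δ × A ⊑ B)) → Γ ⋎ R ⊑ Δ ⋎ T
⋎-⊑ Γ Δ f _ l∈ with at-⋎⁻ Γ l∈
... | A , A∈ , l∈A with f A∈
...   | B , B∈ , A⊑B = at-⋎⁺ Δ B∈ (A⊑B _ l∈A)

⋎-monoʳ : ∀ Γ {R T} → R ⊑ T → Γ ⋎ R ⊑ Γ ⋎ T
⋎-monoʳ Γ {R} {T} R⊑T = ⋎-⊑ Γ Γ λ where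
  (here refl) → T , here refl , R⊑T
  (there i)   → _ , there i , λ _ z → z

⋎-upperˡ : ∀ Γ {R A} → A ∈ Γ → A ⊑ Γ ⋎ R
⋎-upperˡ Γ i _ = at-⋎⁺ Γ (there i)

⋎-upperʳ : ∀ Γ {R} → R ⊑ Γ ⋎ R
⋎-upperʳ Γ _ = at-⋎⁺ Γ (here refl)

-- The list grows at its head: the last formula is the first one attached to R.
data Grown (R : Formula) : List Formula → Set where
  []  : Grown R []
  _∷_ : ∀ {A Γ} → Interacts (Γ ⋎ R) A → Grown R Γ → Grown R (A ∷ Γ)

grown-mono : ∀ {R T Γ} → R ⊑ T → Grown R Γ → Grown T Γ
grown-mono R⊑T [] = []
grown-mono {R} {T} {A ∷ Γ} R⊑T (i ∷ g) =
  interacts-mono (Γ ⋎ R) (Γ ⋎ T) A (⋎-monoʳ Γ {R} {T} R⊑T) i ∷ grown-mono R⊑T g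

grown-++ : ∀ {R Γ Δ} → Grown (Δ ⋎ R) Γ → Grown R Δ → Grown R (Γ ++ Δ)
grown-++ [] h = h
grown-++ {R} {A ∷ Γ} {Δ} (i ∷ g) h =
  subst (λ T → Interacts T A) (sym (⋎-++ Γ Δ)) i ∷ grown-++ g h

-- Every leaf of `A` is also a leaf of `R`, so whatever was attached to `A` can be attached to the
-- root instead.
grown-drop : ∀ {R A} Γ {Δ} → A ⊑ R → Grown R (Γ ++ A ∷ Δ) → Grown R (Γ ++ Δ)
grown-drop []      A⊑R (_ ∷ g) = g
grown-drop {R} {A} (B ∷ Γ) {Δ} A⊑R (i ∷ g) =
  interacts-mono ((Γ ++ A ∷ Δ) ⋎ R) ((Γ ++ Δ) ⋎ R) B (⋎-⊑ (Γ ++ A ∷ Δ) (Γ ++ Δ) f) i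
  ∷ grown-drop Γ A⊑R g
  where
  f : ∀ {C} → C ∈ R ∷ Γ ++ A ∷ Δ → ∃[ D ] (D ∈ R ∷ Γ ++ Δ × C ⊑ D)
  f (here refl) = R , here refl , λ _ z → z
  f (there i) with ∈-resp-↭ (shift A Γ Δ) i
  ... | here refl = R , here refl , A⊑R
  ... | there j   = _ , there j , λ _ z → z

-- A spanning tree of `R ∷ Γ` rooted at `R`, given by an order in which its vertices can be
-- attached.
Reach : Formula → List Formula → Set
Reach R Γ = ∃[ Δ ] (Γ ↭ Δ × Grown R Δ)

reach-mono : ∀ {R T Γ} → R ⊑ T → Reach R Γ → Reach T Γ
reach-mono R⊑T (Δ , p , g) = Δ , p , grown-mono R⊑T g

reach-drop : ∀ {R A Γ} → A ⊑ R → Reach R (A ∷ Γ) → Reach R Γ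
reach-drop {R} {A} A⊑R (Δ , p , g) with ∈-∃++ (∈-resp-↭ p (here refl))
... | Δ₁ , Δ₂ , refl = Δ₁ ++ Δ₂ , drop-∷ (↭-trans p (shift A Δ₁ Δ₂)) , grown-drop Δ₁ A⊑R g

reach-drops : ∀ {R} Γ {Δ} → All (_⊑ R) Γ → Reach R (Γ ++ Δ) → Reach R Δ
reach-drops []      []       r = r
reach-drops (A ∷ Γ) (p ∷ ps) r = reach-drops Γ ps (reach-drop p r)

reach-++ : ∀ {R Γ Δ} → Reach R Γ → Reach R Δ → Reach R (Γ ++ Δ)
reach-++ {R} (Γ′ , p , g) (Δ′ , q , h) =
  Γ′ ++ Δ′ , ↭-trans (++⁺ˡ _ q) (++⁺ʳ Δ′ p) , grown-++ (grown-mono (⋎-upperʳ Δ′) g) h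

reach-snoc : ∀ {A B Γ} → Interacts B A → Reach A Γ → Reach B (A ∷ Γ)
reach-snoc {A} {B} i (Δ , p , g) =
  Δ ++ [ A ] , ↭-trans (prep A p) (++-comm [ A ] Δ) ,
  grown-++ (grown-mono (⋎-upperˡ [ A ] {B} (here refl)) g) (i ∷ [])

-- Interaction is symmetric. If `B` was attached last, to some `C`, the remaining tree is rerooted
-- at `C`, and `C` is then attached to `B`. Otherwise the last vertex stays last, since rerooting
-- below it preserves the set of its possible neighbours.
reroot : ∀ {A B Γ} → Grown A Γ → B ∈ Γ → ∃[ Δ ] (A ∷ Γ ↭ B ∷ Δ × Grown B Δ)
reroot {A} {B} {B ∷ Γ} ((l , l∈∼Γ , l∈B) ∷ g) (here refl)
  with at-⋎⁻ Γ (at-∼⁻ (Γ ⋎ A) l∈∼Γ)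
... | C , C∈ , dl∈C = finish C∈
  where
  -- Dualising the shared literal reverses the edge between `B` and `C`.
  C~B : Interacts B C
  C~B = dual l , ∈-at-∼ B l∈B , dl∈C
  attach : ∀ {Δ} → A ∷ Γ ↭ C ∷ Δ → Grown C Δ → ∃[ Θ ] (A ∷ B ∷ Γ ↭ B ∷ Θ × Grown B Θ)
  attach {Δ} p h with reach-snoc C~B (Δ , ↭-refl , h)
  ... | Θ , q , k = Θ , ↭-trans (swap A B ↭-refl) (prep B (↭-trans p q)) , k
  finish : C ∈ A ∷ Γ → ∃[ Θ ] (A ∷ B ∷ Γ ↭ B ∷ Θ × Grown B Θ)
  finish (here refl) = attach ↭-refl g
  finish (there C∈Γ) with reroot g C∈Γ
  ... | Δ , p , h = attach p h
reroot {A} {B} {C ∷ Γ} (i ∷ g) (there B∈) with reroot g B∈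
... | Δ , p , h = C ∷ Δ
  , ↭-trans (swap A C ↭-refl) (↭-trans (prep C p) (swap C B ↭-refl))
  , interacts-mono (Γ ⋎ A) (Δ ⋎ B) C (⋎-⊑ Γ Δ λ j → _ , ∈-resp-↭ p j , λ _ z → z) i ∷ h

Connected : List Formula → Set
Connected Γ = ∃[ A ] ∃[ Δ ] (Γ ↭ A ∷ Δ × Grown A Δ)

connected-↭ : ∀ {Γ Δ} → Γ ↭ Δ → Connected Γ → Connected Δ
connected-↭ p (A , Θ , q , g) = A , Θ , ↭-trans (↭-sym p) q , g

connected⇒reach : ∀ {A Γ} → Connected (A ∷ Γ) → Reach A Γ
connected⇒reach {A} (B , Δ , p , g) with ∈-resp-↭ p (here refl)
... | here refl = Δ , drop-∷ p , g
... | there A∈Δ with reroot g A∈Δ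
...   | Θ , q , h = Θ , drop-∷ (↭-trans p q) , h

reach⇒connected : ∀ {A Γ} → Reach A Γ → Connected (A ∷ Γ)
reach⇒connected (Δ , p , g) = _ , Δ , prep _ p , g

-- Pulling components out of a conjunct.

disjunction-⋎ : ∀ Γ {R} → IsDisjunction R → IsDisjunction (Γ ⋎ R)
disjunction-⋎ []      d = d
disjunction-⋎ (A ∷ Γ) d = A , _ , ≈-refl

-- One `dlis` per component, last attached first: `Grown` supplies exactly its interaction with what
-- stays behind. `R` must be a disjunction for the side condition to hold when only `R` is left.
extract-grown : ∀ {R Γ} T → IsDisjunction R → All Extractable Γ → Grown R Γ →
                Der (sequentSize Γ + (size R + size T)) (length Γ) ((Γ ⋎ R) ∧ T) (Γ ⋎ (R ∧ T))
extract-grown T d []       []      = done ≈-refl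
extract-grown {R} {A ∷ Γ} T d (e ∷ es) (i ∷ g) =
  relax (≤-reflexive (+-comm (length Γ) 1)) ≤-refl
    (rule {k = 0} (dlis (Γ ⋎ R) T A i e (inj₁ (disjunction-⋎ Γ d))) (≤-reflexive w)
     ▹ relax ≤-refl (≤-reflexive (sym (+-assoc (size A) _ _))) (under-∨ A (extract-grown T d es g)))
  where
  w : size A + (size (Γ ⋎ R) + size T) ≡ size A + sequentSize Γ + (size R + size T)
  w = trans (cong (λ n → size A + (n + size T)) (size-⋎ Γ R))
    (arith (size A) (sequentSize Γ) (size R) (size T))
    where
    arith : ∀ a b c d → a + (b + c + d) ≡ a + b + (c + d)
    arith = solve-∀

sequentSize-↭ : ∀ {Γ Δ} → Γ ↭ Δ → sequentSize Γ ≡ sequentSize Δ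
sequentSize-↭ {Γ} {Δ} p = +-cancelʳ-≡ 1 _ _
  (trans (sym (size-⋎ Γ ff)) (trans (size-≈ (⋎-↭ p)) (size-⋎ Δ ff)))

extract : ∀ {R Γ} T → IsDisjunction R → All Extractable Γ → Reach R Γ →
          Der (sequentSize Γ + (size R + size T)) (length Γ) ((Γ ⋎ R) ∧ T) (Γ ⋎ (R ∧ T))
extract T d es (Δ , p , g) =
  respˡ (∧-cong (⋎-↭ p) ≈-refl)
    (respʳ (relax (≤-reflexive (sym (↭-length p)))
                  (≤-reflexive (cong (_+ _) (sym (sequentSize-↭ p))))
             (extract-grown T d (All-resp-↭ p es) g))
          (⋎-↭ (↭-sym p)))

-- Simulating the Gentzen rules on cores

⊑-refl : ∀ A → A ⊑ A
⊑-refl A _ l∈ = l∈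

⊑-∼∼ : ∀ A → A ⊑ ∼ ∼ A
⊑-∼∼ A l l∈ = subst (_∈ at (∼ ∼ A)) (dual-involutive l) (∈-at-∼ (∼ A) (∈-at-∼ A l∈))

All-⊑ : ∀ {A B Γ} → A ⊑ B → All (_⊑ A) Γ → All (_⊑ B) Γ
All-⊑ A⊑B = All.map λ p l l∈ → A⊑B l (p l l∈)

-- Stated through leaves rather than the shape of `C`, to cover also negated formulae such as
-- `∼ (A ∧ B)` with parts `∼ A` and `∼ B`.
module _ {A B C} (eq : at C ≡ at A ++ at B) where
  ⊑-left : A ⊑ C
  ⊑-left l l∈ = subst (l ∈_) (sym eq) (∈-++⁺ˡ l∈)

  ⊑-right : B ⊑ C
  ⊑-right l l∈ = subst (l ∈_) (sym eq) (∈-++⁺ʳ (at A) l∈)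

  ⊑-++ : ∀ {Γ Δ} → All (_⊑ A) Γ → All (_⊑ B) Δ → All (_⊑ C) (Γ ++ Δ)
  ⊑-++ ps qs = All.++⁺ (All-⊑ {A} {C} ⊑-left ps) (All-⊑ {B} {C} ⊑-right qs)

comps-⊑ : ∀ A → All (_⊑ A) (comps A)
comps-⊑ ff          = []
comps-⊑ tt          = ⊑-refl tt ∷ []
comps-⊑ (atom a)    = ⊑-refl (atom a) ∷ []
comps-⊑ (A ∨ B)     = ⊑-++ {A} {B} {A ∨ B} refl (comps-⊑ A) (comps-⊑ B)
comps-⊑ (A ∧ B)     = ⊑-refl (A ∧ B) ∷ []
comps-⊑ (∼ ff)      = ⊑-refl tt ∷ []
comps-⊑ (∼ tt)      = []
comps-⊑ (∼ atom a)  = ⊑-refl (∼ atom a) ∷ []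
comps-⊑ (∼ (A ∨ B)) = ⊑-refl (∼ (A ∨ B)) ∷ []
comps-⊑ (∼ (A ∧ B)) =
  ⊑-++ {∼ A} {∼ B} {∼ (A ∧ B)} (map-++ dual (at A) (at B)) (comps-⊑ (∼ A)) (comps-⊑ (∼ B))
comps-⊑ (∼ ∼ A)     = All-⊑ {A} {∼ ∼ A} (⊑-∼∼ A) (comps-⊑ A)

⊆-++⁻ : ∀ Γ {Δ Θ : List Formula} → Θ ⊆ Γ ++ Δ →
        ∃[ Θ₁ ] ∃[ Θ₂ ] (Θ ≡ Θ₁ ++ Θ₂ × Θ₁ ⊆ Γ × Θ₂ ⊆ Δ)
⊆-++⁻ [] s = [] , _ , refl , [] , s
⊆-++⁻ (A ∷ Γ) (.A ∷ʳ s) with ⊆-++⁻ Γ s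
... | Θ₁ , Θ₂ , e , s₁ , s₂ = Θ₁ , Θ₂ , e , A ∷ʳ s₁ , s₂
⊆-++⁻ (A ∷ Γ) (refl ∷ s) with ⊆-++⁻ Γ s
... | Θ₁ , Θ₂ , refl , s₁ , s₂ = A ∷ Θ₁ , Θ₂ , refl , refl ∷ s₁ , s₂

⊆-resp-↭ : ∀ {Θ Γ Δ : List Formula} → Γ ↭ Δ → Θ ⊆ Γ → ∃[ Θ′ ] (Θ ↭ Θ′ × Θ′ ⊆ Δ)
⊆-resp-↭ refl s = _ , ↭-refl , s
⊆-resp-↭ (prep A p) (.A ∷ʳ s) with ⊆-resp-↭ p s
... | Θ , q , t = Θ , q , A ∷ʳ t
⊆-resp-↭ (prep A p) (refl ∷ s) with ⊆-resp-↭ p s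
... | Θ , q , t = A ∷ Θ , prep A q , refl ∷ t
⊆-resp-↭ (swap A B p) (.A ∷ʳ .B ∷ʳ s) with ⊆-resp-↭ p s
... | Θ , q , t = Θ , q , B ∷ʳ A ∷ʳ t
⊆-resp-↭ (swap A B p) (.A ∷ʳ refl ∷ s) with ⊆-resp-↭ p s
... | Θ , q , t = B ∷ Θ , prep B q , refl ∷ A ∷ʳ t
⊆-resp-↭ (swap A B p) (refl ∷ .B ∷ʳ s) with ⊆-resp-↭ p s
... | Θ , q , t = A ∷ Θ , prep A q , B ∷ʳ refl ∷ t
⊆-resp-↭ (swap A B p) (refl ∷ refl ∷ s) with ⊆-resp-↭ p s
... | Θ , q , t = B ∷ A ∷ Θ , swap A B q , refl ∷ refl ∷ t
⊆-resp-↭ (_↭_.trans p q) s with ⊆-resp-↭ p s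
... | Θ , p′ , t with ⊆-resp-↭ q t
...   | Θ′ , q′ , u = Θ′ , ↭-trans p′ q′ , u

-- The components of `A` missing from the core are weakened in before `A` is assembled. The tail
-- `ff` is kept because `A ∨ ff` is a disjunction, as `dlis` demands, whatever `A` is.
gather : ∀ {A A₀} Γ → A₀ ⊆ comps A →
         Der (sequentSize Γ + (size A + 1)) (size A * 3) ((A₀ ++ Γ) ⋎ ff) (Γ ⋎ (A ∨ ff))
gather {A} {A₀} Γ s =
  respˡ (≈-trans (⋎-↭ (++-comm A₀ Γ)) (≡⇒≈ (⋎-++ Γ A₀)))
    (under-⋎ Γ (relax steps ≤-refl
      (relax ≤-refl (+-monoˡ-≤ 1 (sequentSize-comps A)) (weaken-⋎ ff s) ▹ assemble A ff)))
  where
  -- Two steps per component for weakening, and `size A` for assembling.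
  steps : size A + length (comps A) * 2 ≤ size A * 3
  steps = ≤-trans
    (+-monoʳ-≤ (size A) (*-monoˡ-≤ 2 (≤-trans (length≤sequentSize (comps A)) (sequentSize-comps A))))
    (≤-reflexive (arith (size A)))
    where
    arith : ∀ n → n + n * 2 ≡ n * 3
    arith = solve-∀

-- Both premises are gathered into `P ∧ Q`, then `Γ` and `Δ` are pulled out in turn. The summand
-- with factor 6 arises because `P` and `Q` each have size at most three times the sum of the sizes
-- of `A`, `B`, `Γ` and `Δ`.
∧-derivation :
  ∀ A B {C A₀ B₀ c d} Γ Δ → A ∧ B ≈ C → A₀ ⊆ comps A → B₀ ⊆ comps B →
  All Extractable Γ → All Extractable Δ → Reach (A ∨ ff) Γ → Reach (B ∨ ff) Δ →
  Der c c tt ((A₀ ++ Γ) ⋎ ff) → Der d d tt ((B₀ ++ Δ) ⋎ ff) →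
  let e = c + d + 6 * (size A + size B + (sequentSize Γ + sequentSize Δ)) in
  Der e e tt ((C ∷ Γ ++ Δ) ⋎ ff)
∧-derivation A B {C} {A₀} {B₀} {c} {d} Γ Δ A∧B≈C A₀⊆ B₀⊆ Γ-ext Δ-ext Γ-reach Δ-reach Π Π′ =
  relax steps ≤-refl (respʳ
    (   relax ≤-refl (≤-trans (m≤m+n c d) (m≤m+n (c + d) _)) Π
      ▹ relax ≤-refl (≤-trans P≤ 3s≤e) (gather Γ A₀⊆)
      -- The `tt` created here is where the second proof starts, inside the context given by `P`.
      ▹ rule {k = 0} (u₂↓ P) (6s⇒e (+-mono-≤ P≤′ 1≤3s))
      ▹ relax ≤-refl P∧ (under-∧ P
          (relax ≤-refl (m≤m+n d (3 * s)) Π′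
           ▹ relax ≤-refl (≤-trans Q≤ (m≤n+m (3 * s) d)) (gather Δ B₀⊆)))
      ▹ relax {k′ = sequentSize Γ} (length≤sequentSize Γ)
          (6s⇒e (≤-trans (≤-reflexive (sym (+-assoc γ (a + 1) (size Q)))) (+-mono-≤ P≤ Q≤′)))
          (extract Q (A , ff , ≈-refl) Γ-ext Γ-reach)
      ▹ relax {k′ = sequentSize Δ} (length≤sequentSize Δ)
          (6s⇒e (≤-trans (≤-reflexive (arith₁ γ δ a b)) (+-mono-≤ P≤ Q≤)))
          (under-⋎ Γ (respˡ (∧-comm (A ∨ ff) Q) (extract (A ∨ ff) (B , ff , ≈-refl) Δ-ext Δ-reach)))
      -- With both contexts outside, the two auxiliary `ff` can go; a single one is put back as the
      -- tail of the resulting list.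
      ▹ relax ≤-refl Γ⋎Δ⋎ (under-⋎ Γ (under-⋎ Δ
          (  relax ≤-refl w₁ (under-∧ (B ∨ ff) (drop-ff A))
           ▹ relax ≤-refl w₂ (respˡ (∧-comm (B ∨ ff) A) (under-∧ A (drop-ff B)))
           ▹ rule {k = 0} (u₁↓ (A ∧ B)) w₃))))
    (≈-trans (⋎-cong Γ (⋎-cong Δ (∨-cong A∧B≈C ≈-refl)))
      (≈-trans (≡⇒≈ (sym (⋎-++ Γ Δ)))
        (≈-trans (≡⇒≈ (sym (⋎-++ (Γ ++ Δ) [ C ]))) (⋎-↭ (++-comm (Γ ++ Δ) [ C ]))))))
  where
  a b γ δ s e : ℕ
  a = size A
  b = size B
  γ = sequentSize Γ
  δ = sequentSize Δ
  s = a + b + (γ + δ)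
  e = c + d + 6 * s
  P Q : Formula
  P = Γ ⋎ (A ∨ ff)
  Q = Δ ⋎ (B ∨ ff)

  a≤s : a ≤ s
  a≤s = m≤n⇒m≤n+o _ (m≤m+n a b)
  b≤s : b ≤ s
  b≤s = m≤n⇒m≤n+o _ (m≤n+m b a)
  γ≤s : γ ≤ s
  γ≤s = m≤n⇒m≤o+n (a + b) (m≤m+n γ δ)
  δ≤s : δ ≤ s
  δ≤s = m≤n⇒m≤o+n (a + b) (m≤n+m δ γ)
  1≤s : 1 ≤ s
  1≤s = ≤-trans (1≤size A) a≤s

  triple : ∀ {x y z} → x ≤ s → y ≤ s → z ≤ s → x + (y + z) ≤ 3 * s
  triple p q r = ≤-trans (+-mono-≤ p (+-mono-≤ q r)) (≤-reflexive (arith s))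
    where
    arith : ∀ n → n + (n + n) ≡ 3 * n
    arith = solve-∀

  1≤3s : 1 ≤ 3 * s
  1≤3s = ≤-trans 1≤s (m≤m+n s _)
  P≤ : γ + (a + 1) ≤ 3 * s
  P≤ = triple γ≤s a≤s 1≤s
  Q≤ : δ + (b + 1) ≤ 3 * s
  Q≤ = triple δ≤s b≤s 1≤s
  P≤′ : size P ≤ 3 * s
  P≤′ = ≤-trans (≤-reflexive (size-⋎ Γ (A ∨ ff))) P≤
  Q≤′ : size Q ≤ 3 * s
  Q≤′ = ≤-trans (≤-reflexive (size-⋎ Δ (B ∨ ff))) Q≤

  6s⇒e : ∀ {n} → n ≤ 3 * s + 3 * s → n ≤ e
  6s⇒e p = ≤-trans p (≤-trans (≤-reflexive (sym (*-distribʳ-+ s 3 3))) (m≤n+m (6 * s) (c + d)))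
  3s≤e : 3 * s ≤ e
  3s≤e = 6s⇒e (m≤m+n (3 * s) (3 * s))

  arith₁ : ∀ g h x y → g + (h + (y + 1 + (x + 1))) ≡ g + (x + 1) + (h + (y + 1))
  arith₁ = solve-∀

  P∧ : size P + (d + 3 * s) ≤ e
  P∧ = ≤-trans (+-monoˡ-≤ (d + 3 * s) P≤′)
    (≤-trans (≤-reflexive (arith s d)) (+-monoˡ-≤ (6 * s) (m≤n+m d c)))
    where
    arith : ∀ n m → 3 * n + (m + 3 * n) ≡ m + 6 * n
    arith = solve-∀

  w : ℕ
  w = 1 + (a + a + (b + b))
  w₁ : b + 1 + (a + a) ≤ w
  w₁ = ≤-trans (≤-reflexive (arith a b)) (s≤s (+-monoʳ-≤ (a + a) (m≤m+n b b)))
    where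
    arith : ∀ x y → y + 1 + (x + x) ≡ 1 + (x + x + y)
    arith = solve-∀
  w₂ : a + (b + b) ≤ w
  w₂ = m≤n⇒m≤1+n (+-monoˡ-≤ (b + b) (m≤m+n a a))
  w₃ : a + b + 1 ≤ w
  w₃ = ≤-trans (≤-reflexive (+-comm (a + b) 1)) (s≤s (+-mono-≤ (m≤m+n a a) (m≤m+n b b)))
  Γ⋎Δ⋎ : γ + (δ + w) ≤ e
  Γ⋎Δ⋎ = 6s⇒e (≤-trans (≤-reflexive (arith γ δ a b))
    (+-mono-≤ (triple γ≤s δ≤s 1≤s) (triple ab≤s ab≤s z≤n)))
    where
    ab≤s : a + b ≤ s
    ab≤s = m≤m+n (a + b) _
    arith : ∀ g h x y → g + (h + (1 + (x + x + (y + y)))) ≡ g + (h + 1) + (x + y + (x + y + 0))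
    arith = solve-∀

  steps : 1 + (2 + 2) + (δ + (γ + (b * 3 + d + (1 + (a * 3 + c))))) ≤ e
  -- The constant 6 counts one `u₂↓`, two uses of `drop-ff` with two steps each, and one `u₁↓`.
  steps = ≤-trans (≤-reflexive (arith a b γ δ c d))
    (+-monoʳ-≤ (c + d) (≤-trans (+-mono-≤ tail₁ tail₂) (≤-reflexive (sym (*-distribʳ-+ s 3 3)))))
    where
    arith : ∀ x y g h m n → 1 + (2 + 2) + (h + (g + (y * 3 + n + (1 + (x * 3 + m))))) ≡
            m + n + (3 * (x + y) + (g + h) + 6)
    arith = solve-∀
    tail₁ : 3 * (a + b) + (γ + δ) ≤ 3 * s
    tail₁ = ≤-trans (+-monoʳ-≤ (3 * (a + b)) (m≤m+n (γ + δ) _))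
      (≤-reflexive (sym (*-distribˡ-+ 3 (a + b) (γ + δ))))
    tail₂ : 6 ≤ 3 * s
    tail₂ = *-monoʳ-≤ 3 (m≤n⇒m≤n+o (γ + δ) (+-mono-≤ (1≤size A) (1≤size B)))

last-size : ∀ {w k P Q} → size P ≤ w → Der w k P Q → size Q ≤ w
last-size p (done e)     = ≤-trans (≤-reflexive (sym (size-≈ e))) p
last-size _ (step _ _ b) = b

-- A single number bounds both length and width, so the size of the proof is essentially its square.
record Provable (Γ : List Formula) (c : ℕ) : Set where
  constructor provable
  field
    {core}    : List Formula
    core⊆     : core ⊆ Γ
    connected : Connected core
    proof     : Der c c tt (core ⋎ ff)

open Provable

provable-relax : ∀ {Γ c d} → c ≤ d → Provable Γ c → Provable Γ d
provable-relax c≤d (provable s conn Π) = provable s conn (relax c≤d c≤d Π)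

provable-↭ : ∀ {Γ Δ c} → Γ ↭ Δ → Provable Γ c → Provable Δ c
provable-↭ p (provable s conn Π) with ⊆-resp-↭ p s
... | Θ , q , t = provable t (connected-↭ q conn) (respʳ Π (⋎-↭ q))

-- Weakening takes no step: the core stays the same.
provable-++ : ∀ {Γ c} Δ → Provable Γ c → Provable (Δ ++ Γ) c
provable-++ Δ (provable s conn Π) = provable (⊆-++⁺ˡ Δ s) conn Π

-- Only a core containing both copies needs a `c↓`. Rooting its graph at one copy allows the other
-- to be dropped.
provable-contract : ∀ {A Γ c} → Provable (A ∷ A ∷ Γ) c → Provable (A ∷ Γ) (1 + c)
provable-contract p@(provable (A ∷ʳ s)        _ _) =
  provable-relax (n≤1+n _) (provable s (connected p) (proof p))
provable-contract p@(provable (refl ∷ _ ∷ʳ s) _ _) =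
  provable-relax (n≤1+n _) (provable (refl ∷ s) (connected p) (proof p))
provable-contract {A} {c = c} (provable (_∷_ {xs = .A ∷ Θ} refl (refl ∷ s)) conn Π) =
  provable (refl ∷ s)
    (reach⇒connected (reach-drop (⊑-refl A) (connected⇒reach conn)))
    (step (relax ≤-refl (n≤1+n c) Π)
      (instance-in (□ ∨ˡ (Θ ⋎ ff)) (≈-sym (∨-assoc A A _)) (c↓ A) ≈-refl)
      -- The width `1 + c` is at least the size of the initial `tt`, as `last-size` requires in case
      -- `Π` has no steps.
      (≤-trans (m≤n+m _ (size A)) (last-size (s≤s z≤n) (relax ≤-refl (n≤1+n c) Π))))

provable-contract-++ : ∀ Δ {Γ c} → Provable (Δ ++ Δ ++ Γ) c → Provable (Δ ++ Γ) (length Δ + c)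
provable-contract-++ []      p = p
provable-contract-++ (A ∷ Δ) {Γ} {c} p =
  provable-relax (≤-reflexive (+-suc (length Δ) c))
    (provable-↭ (shift A Δ Γ)
      (provable-contract-++ Δ
        (provable-↭ (↭-sym (↭-trans (++⁺ˡ Δ (shift A Δ Γ)) (shift A Δ (Δ ++ Γ))))
          (provable-contract (provable-↭ (prep A (shift A Δ (Δ ++ Γ))) p)))))

-- If some component of `A` is in the core, the first one becomes the root and is enlarged to `A`,
-- which then absorbs the others because their leaves occur in `A`.
connected-core : ∀ {A A₀ Γ} → A₀ ⊆ comps A → Connected (A₀ ++ Γ) → A₀ ≡ [] ⊎ Reach A Γ
connected-core {A₀ = []}     _ _    = inj₁ refl
connected-core {A} {B ∷ A₀} {Γ} s conn with All-resp-⊆ s (comps-⊑ A)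
... | B⊑A ∷ A₀⊑A = inj₂ (reach-drops A₀ A₀⊑A (reach-mono B⊑A (connected⇒reach conn)))

-- `C` is kept apart from `A ∧ B` because the identity axiom also needs the case of a negated
-- disjunction, which is a conjunction only up to `≈`.
provable-∧ :
  ∀ A B {C c d Γ Δ} → A ∧ B ≈ C → at C ≡ at A ++ at B → All Extractable Γ → All Extractable Δ →
  Provable (comps A ++ Γ) c → Provable (comps B ++ Δ) d →
  Provable (C ∷ Γ ++ Δ) (c + d + 6 * (size A + size B + (sequentSize Γ + sequentSize Δ)))
provable-∧ A B {C} {c} {d} {Γ} {Δ} A∧B≈C eq Γ-ext Δ-ext (provable s conn Π) (provable t conn′ Π′)
  with ⊆-++⁻ (comps A) s | ⊆-++⁻ (comps B) t
... | A₀ , Γ₀ , refl , A₀⊆ , Γ₀⊆ | B₀ , Δ₀ , refl , B₀⊆ , Δ₀⊆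
  with connected-core {A} A₀⊆ conn | connected-core {B} B₀⊆ conn′
... | inj₁ refl | _ =
  provable-relax (m≤n⇒m≤n+o _ (m≤m+n c d)) (provable (C ∷ʳ ⊆-++⁺ʳ Δ Γ₀⊆) conn Π)
... | inj₂ _ | inj₁ refl =
  provable-relax (m≤n⇒m≤n+o _ (m≤n+m d c)) (provable (C ∷ʳ ⊆-++⁺ˡ Γ Δ₀⊆) conn′ Π′)
... | inj₂ A-reach | inj₂ B-reach =
  provable-relax
    (+-monoʳ-≤ (c + d) (*-monoʳ-≤ 6 (+-monoʳ-≤ (size A + size B)
      (+-mono-≤ (sequentSize-⊆ Γ₀⊆) (sequentSize-⊆ Δ₀⊆)))))
    (provable (refl ∷ ⊆-++⁺ Γ₀⊆ Δ₀⊆)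
      (reach⇒connected
        (reach-++ (reach-mono (⊑-left {A} {B} {C} eq) A-reach)
                  (reach-mono (⊑-right {A} {B} {C} eq) B-reach)))
      (∧-derivation A B Γ₀ Δ₀ A∧B≈C A₀⊆ B₀⊆
        (All-resp-⊆ Γ₀⊆ Γ-ext) (All-resp-⊆ Δ₀⊆ Δ-ext)
        (reach-mono (⊑-left {A} {ff} {A ∨ ff} refl) A-reach)
        (reach-mono (⊑-left {B} {ff} {B ∨ ff} refl) B-reach) Π Π′))

-- Cost estimates.

cost : ℕ → ℕ
cost n = 12 * (n * n)

cost-mono : ∀ {m n} → m ≤ n → cost m ≤ cost n
cost-mono p = *-monoʳ-≤ 12 (*-mono-≤ p p)

-- Superadditivity lets the costs of the premises and the linear charge for the conclusion be
-- absorbed into the cost of the total size. The growth is quadratic because an identity axiom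
-- expands into linearly many conjunctions, each of linear charge.
cost-+ : ∀ m n → cost m + cost n ≤ cost (m + n)
cost-+ m n = ≤-trans (m≤m+n _ (24 * (m * n))) (≤-reflexive (arith m n))
  where
  arith : ∀ x y → 12 * (x * x) + 12 * (y * y) + 24 * (x * y) ≡ 12 * ((x + y) * (x + y))
  arith = solve-∀

6*n≤cost : ∀ n → 6 * n ≤ cost n
6*n≤cost zero    = z≤n
6*n≤cost (suc n) = *-mono-≤ {6} {12} (m≤m+n 6 6) (m≤m+n (suc n) (n * suc n))

-- Room for a conjunction of cost 6 · 2(m + n), since m + n ≤ 2mn for positive m and n.
cost-∧ : ∀ {m n} → 1 ≤ m → 1 ≤ n → ∀ {k} → k ≤ m + n →
         cost m + cost n + 6 * (m + n + k) ≤ cost (m + n)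
cost-∧ {suc m} {suc n} _ _ {k} k≤ =
  ≤-trans (+-monoʳ-≤ (cost (suc m) + cost (suc n)) (*-monoʳ-≤ 6 (+-monoʳ-≤ (suc m + suc n) k≤)))
    (≤-trans (m≤m+n _ (12 * (m + n + 2 * (m * n)))) (≤-reflexive (arith m n)))
  where
  arith : ∀ x y → 12 * ((1 + x) * (1 + x)) + 12 * ((1 + y) * (1 + y))
                    + 6 * (1 + x + (1 + y) + (1 + x + (1 + y))) + 12 * (x + y + 2 * (x * y))
                  ≡ 12 * ((1 + x + (1 + y)) * (1 + x + (1 + y)))
  arith = solve-∀

-- The bound is `cost 1`. Identity on either unit reduces to this case, because `comps` erases the
-- dual unit.
provable-tt : Provable [ tt ] 12
provable-tt = provable (refl ∷ []) (tt , [] , ↭-refl , [])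
  (relax (m≤m+n 1 11) (m≤m+n 2 10) (rule {k = 0} (u₁↓ tt) ≤-refl))

-- `ai↓` is atomic, so the axiom is expanded by recursion: one of a compound formula and its
-- negation is a conjunction, and the components of the other provide the two contexts.
provable-identity : ∀ A → Provable (comps A ++ comps (∼ A)) (cost (size A))
provable-identity-∧ :
  ∀ A B {C} → A ∧ B ≈ C → at C ≡ at A ++ at B → ∀ Γ Δ →
  All Extractable Γ → All Extractable Δ → sequentSize Γ ≤ size A → sequentSize Δ ≤ size B →
  Provable (comps A ++ Γ) (cost (size A)) → Provable (comps B ++ Δ) (cost (size B)) →
  Provable (C ∷ Γ ++ Δ) (cost (size A + size B))
provable-identity-∧ A B e eq Γ Δ Γ-ext Δ-ext Γ≤ Δ≤ p q =
  provable-relax (cost-∧ (1≤size A) (1≤size B) (+-mono-≤ Γ≤ Δ≤))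
    (provable-∧ A B e eq Γ-ext Δ-ext p q)

provable-identity ff       = provable-tt
provable-identity tt       = provable-tt
provable-identity (atom a) =
  provable (refl ∷ refl ∷ [])
    (atom a , [ ∼ atom a ] , ↭-refl , (neg a , here refl , here refl) ∷ [])
    (relax (m≤m+n 2 10) (m≤m+n 3 9)
      (respʳ (step (rule {k = 0} (ai↓ a) (n≤1+n 2)) (instance-in □ ≈-refl (u₁↓ _) ≈-refl) ≤-refl)
            (∨-assoc _ _ _)))
provable-identity (A ∧ B)  =
  provable-identity-∧ A B ≈-refl refl (comps (∼ A)) (comps (∼ B))
    (comps-extractable (∼ A)) (comps-extractable (∼ B))
    (sequentSize-comps (∼ A)) (sequentSize-comps (∼ B))
    (provable-identity A) (provable-identity B)
provable-identity (A ∨ B)  =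
  provable-↭ (++-comm [ ∼ (A ∨ B) ] (comps A ++ comps B))
    (provable-identity-∧ (∼ A) (∼ B) (≈-sym (∼-∨ A B)) (map-++ dual (at A) (at B)) (comps A) (comps B)
      (comps-extractable A) (comps-extractable B) (sequentSize-comps A) (sequentSize-comps B)
      (provable-↭ (++-comm (comps A) (comps (∼ A))) (provable-identity A))
      (provable-↭ (++-comm (comps B) (comps (∼ B))) (provable-identity B)))
-- `comps (∼ ∼ A)` computes to `comps A`, so only the two halves are exchanged.
provable-identity (∼ A)    =
  provable-↭ (++-comm (comps A) (comps (∼ A))) (provable-identity A)

flat-extractable : ∀ φ → All Extractable (flat φ)
flat-extractable []      = []
flat-extractable (A ∷ φ) = All.++⁺ (comps-extractable A) (flat-extractable φ)

provable-≡ : ∀ {Γ Δ c} → Γ ≡ Δ → Provable Γ c → Provable Δ c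
provable-≡ refl p = p

-- Among the rules with premises, only contraction and conjunction may add steps; the others leave
-- the derivation unchanged up to reordering the core.
⊢⇒provable : ∀ {φ} (Φ : ⊢ φ) → Provable (flat φ) (cost (gentzenSize Φ))
⊢⇒provable (exchange p Φ) = provable-↭ (flat-↭ p) (⊢⇒provable Φ)
⊢⇒provable (identity A) =
  provable-relax (cost-mono (m≤m+n (size A) _))
    (provable-≡ (cong (comps A ++_) (sym (++-identityʳ (comps (∼ A))))) (provable-identity A))
⊢⇒provable truth = provable-tt
⊢⇒provable (weakening A Φ) =
  provable-relax (cost-mono (m≤m+n (gentzenSize Φ) _)) (provable-++ (comps A) (⊢⇒provable Φ))
⊢⇒provable (contraction {φ} {A} Φ) =
  provable-relax bound (provable-contract-++ (comps A) (⊢⇒provable Φ))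
  where
  g s : ℕ
  g = gentzenSize Φ
  s = sequentSize (A ∷ φ)
  -- One `c↓` per component of `A` at most, charged to the size `s` of the conclusion.
  bound : length (comps A) + cost g ≤ cost (g + s)
  bound = ≤-trans (≤-reflexive (+-comm (length (comps A)) (cost g)))
    (≤-trans (+-monoʳ-≤ (cost g)
        (≤-trans (length≤sequentSize (comps A))
          (≤-trans (sequentSize-comps A)
            (≤-trans (m≤m+n (size A) _) (≤-trans (m≤m+n s _) (6*n≤cost s))))))
      (cost-+ g s))
⊢⇒provable (∨-rule {φ} {A} {B} Φ) =
  provable-relax (cost-mono (m≤m+n (gentzenSize Φ) _))
    (provable-≡ (sym (++-assoc (comps A) (comps B) (flat φ))) (⊢⇒provable Φ))
⊢⇒provable (∧-rule {φ} {ψ} {A} {B} Φ Ψ) =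
  provable-relax bound
    (provable-≡ (cong (A ∧ B ∷_) (sym (concatMap-++ comps φ ψ)))
      (provable-∧ A B ≈-refl refl (flat-extractable φ) (flat-extractable ψ)
        (⊢⇒provable Φ) (⊢⇒provable Ψ)))
  where
  g h s : ℕ
  g = gentzenSize Φ
  h = gentzenSize Ψ
  s = sequentSize (A ∧ B ∷ φ ++ ψ)
  bound : cost g + cost h + 6 * (size A + size B + (sequentSize (flat φ) + sequentSize (flat ψ)))
          ≤ cost (g + h + s)
  bound = ≤-trans
    (+-mono-≤ (cost-+ g h) (≤-trans (*-monoʳ-≤ 6 flat≤s) (6*n≤cost s)))
    (cost-+ (g + h) s)
    where
    flat≤s : size A + size B + (sequentSize (flat φ) + sequentSize (flat ψ)) ≤ s
    flat≤s = +-monoʳ-≤ (size A + size B)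
      (≤-trans (+-mono-≤ (sequentSize-flat φ) (sequentSize-flat ψ))
        (≤-reflexive (sym (sequentSize-++ φ ψ))))

-- From components back to formulae.

assemble-flat : ∀ φ R → Der (sequentSize φ + size R) (sequentSize φ) (flat φ ⋎ R) (φ ⋎ R)
assemble-flat []      R = done ≈-refl
assemble-flat (A ∷ φ) R = respˡ (≡⇒≈ (⋎-++ (comps A) (flat φ)))
  (relax (≤-reflexive (+-comm (sequentSize φ) (size A))) ≤-refl
    (relax ≤-refl w (assemble A (flat φ ⋎ R))
     ▹ relax ≤-refl (≤-reflexive (sym (+-assoc (size A) _ _))) (under-∨ A (assemble-flat φ R))))
  where
  w : size A + size (flat φ ⋎ R) ≤ size A + sequentSize φ + size R
  w = ≤-trans
    (+-monoʳ-≤ (size A) (≤-trans (≤-reflexive (size-⋎ (flat φ) R))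
      (+-monoˡ-≤ (size R) (sequentSize-flat φ))))
    (≤-reflexive (sym (+-assoc (size A) _ _)))

-- `⋁` of a nonempty sequent has no tail `ff`, so the tail is merged into the last formula.
⋎-ff⇒⋁ : ∀ φ → Der (sequentSize φ + sequentSize φ) 2 (φ ⋎ ff) (⋁ φ)
⋎-ff⇒⋁ []          = done ≈-refl
⋎-ff⇒⋁ (A ∷ [])    =
  relax ≤-refl (+-mono-≤ (m≤m+n (size A) 0) (m≤m+n (size A) 0)) (drop-ff A)
⋎-ff⇒⋁ (A ∷ B ∷ φ) =
  relax ≤-refl
    (≤-trans (+-monoʳ-≤ (size A) (m≤n+m _ (size A)))
             (≤-reflexive (arith (size A) (sequentSize (B ∷ φ)))))
    (under-∨ A (⋎-ff⇒⋁ (B ∷ φ)))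
  where
  arith : ∀ x y → x + (x + (y + y)) ≡ x + y + (x + y)
  arith = solve-∀

sequentSize≤gentzenSize : ∀ {φ} (Φ : ⊢ φ) → sequentSize φ ≤ gentzenSize Φ
sequentSize≤gentzenSize (exchange p Φ)  =
  ≤-trans (≤-reflexive (sym (sequentSize-↭ p))) (sequentSize≤gentzenSize Φ)
sequentSize≤gentzenSize (identity A)    = ≤-refl
sequentSize≤gentzenSize truth           = ≤-refl
sequentSize≤gentzenSize (weakening A Φ) = m≤n+m _ (gentzenSize Φ)
sequentSize≤gentzenSize (contraction Φ) = m≤n+m _ (gentzenSize Φ)
sequentSize≤gentzenSize (∨-rule Φ)      = m≤n+m _ (gentzenSize Φ)
sequentSize≤gentzenSize (∧-rule Φ Ψ)    = m≤n+m _ (gentzenSize Φ + gentzenSize Ψ)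

-- `cost n` for deriving the core, `2 * n` for weakening in the missing components, `n` for
-- assembling the formulae, and 2 for dropping the tail `ff`.
bound : ℕ → ℕ
bound n = 2 + (3 * n + cost n)

provable⇒der : ∀ φ {n} → sequentSize φ ≤ n → Provable (flat φ) (cost n) →
               Der (bound n) (bound n) tt (⋁ φ)
provable⇒der φ {n} s≤n (provable c⊆ _ Π) =
  relax steps ≤-refl
    (  relax ≤-refl (≤-trans (m≤n+m (cost n) (3 * n)) (m≤n+m _ 2)) Π
     ▹ relax ≤-refl (n+1 (≤-trans (sequentSize-flat φ) s≤n)) (weaken-⋎ ff c⊆)
     ▹ relax ≤-refl (n+1 s≤n) (assemble-flat φ ff)
     ▹ relax ≤-refl w (⋎-ff⇒⋁ φ))
  where
  n+1 : ∀ {m} → m ≤ n → m + 1 ≤ bound n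
  n+1 {m} m≤n = ≤-trans (≤-reflexive (+-comm m 1))
    (s≤s (m≤n⇒m≤1+n (m≤n⇒m≤n+o (cost n) (m≤n⇒m≤n+o _ m≤n))))
  w : sequentSize φ + sequentSize φ ≤ bound n
  w = ≤-trans (+-mono-≤ s≤n (m≤n⇒m≤n+o (n + 0) s≤n)) (m≤n⇒m≤o+n 2 (m≤m+n (3 * n) (cost n)))
  steps : 2 + (sequentSize φ + (length (flat φ) * 2 + cost n)) ≤ bound n
  steps = +-monoʳ-≤ 2 (≤-trans
    (+-mono-≤ s≤n (+-monoˡ-≤ (cost n)
      (*-monoˡ-≤ 2 (≤-trans (length≤sequentSize (flat φ)) (≤-trans (sequentSize-flat φ) s≤n)))))
    (≤-reflexive (arith n (cost n))))
    where
    arith : ∀ x y → x + (x * 2 + y) ≡ 3 * x + y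
    arith = solve-∀

corollary3p12 : Σ[ p ∈ Polynomial ]
    (∀ φ (Φ : ⊢ φ) →
    Σ[ Π ∈ KSdli (⋁ φ) ] KSdliSize Π ≤ eval p (gentzenSize Φ))
-- These are the coefficients of `1 + bound n * bound n`, the length times the width plus the
-- initial `tt`.
corollary3p12 = 5 ∷ 12 ∷ 57 ∷ 72 ∷ 144 ∷ [] , λ φ Φ →
  let Π , Π≤ = toKSdli (provable⇒der φ (sequentSize≤gentzenSize Φ) (⊢⇒provable Φ))
  in Π , ≤-trans Π≤ (≤-reflexive (expand (gentzenSize Φ)))
  where
  expand : ∀ n → 1 + (2 + (3 * n + 12 * (n * n))) * (2 + (3 * n + 12 * (n * n)))
                 ≡ 5 + n * (12 + n * (57 + n * (72 + n * (144 + n * 0))))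
  expand = solve-∀
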